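{- Consider directed graphs without antiparallel edges, and let $\Psi_{\mathrm{sink}}$ be the property of containing a sink. Then $\Psi_{\mathrm{sink}}$ is nontrivial on $k$-vertex graphs for every $k\geq 2$ (i.e. some $k$-vertex directed graph without antiparallel edges has a sink and some other does not), and the following problem can be solved in linear time: given a directed graph $G$ without antiparallel edges and $k\in\mathbb{N}$, compute the number of $k$-element subsets $X\subseteq V(G)$ such that the induced subgraph $G[X]$ contains a sink.
   Context: Directed graphs are finite, without self-loops or multiple edges; "without antiparallel edges" means that for any two vertices $u,v$ at most one of the edges $(u,v)$ and $(v,u)$ is present. A sink of a directed graph $H$ is a vertex $s\in V(H)$ such that $(u,s)\in E(H)$ for all $u\in V(H)\setminus\{s\}$. -}

module Defs where

open import Data.Bool using (if_then_else_)
open import Data.Fin using (Fin; toℕ)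
open import Data.Fin.Subset using (Subset; ∣_∣) renaming (_∈_ to _∈ₛ_)
open import Data.List using (List; []; _∷_; _++_; length; map; concatMap; foldr; allFin)
open import Data.List.Membership.Propositional using (_∈_)
open import Data.List.Relation.Unary.Unique.Propositional using (Unique)
open import Data.Maybe using (Maybe; just; nothing)
open import Data.Nat using (ℕ; zero; suc; _+_; _*_; _∸_; _^_; _/_; _⊔_; _≤_; _≡ᵇ_)
open import Data.Nat.ListAction using (sum)
open import Data.Product using (Σ; ∃-syntax; _×_; _,_; proj₁)
open import Function.Bundles using (_⇔_)
open import Level using (0ℓ)
open import Relation.Binary using (Rel; Decidable)
open import Relation.Binary.PropositionalEquality using (_≡_; _≢_)
open import Relation.Nullary using (¬_)

------------------------------------------------------------------------
-- Directed graphs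

record Digraph (V : Set) : Set₁ where
  field
    E      : Rel V 0ℓ
    E?     : Decidable E
    noLoop : ∀ v → ¬ E v v

open Digraph public

NoAntiparallel : {V : Set} → Digraph V → Set
NoAntiparallel G = ∀ u v → ¬ (E G u v × E G v u)

DigraphProperty : Set₁
DigraphProperty = {V : Set} → Digraph V → Set

IsSink : {V : Set} → Digraph V → V → Set
IsSink G s = ∀ u → u ≢ s → E G u s

Ψsink : {V : Set} → Digraph V → Set
Ψsink G = ∃[ s ] IsSink G s

_[_] : {n : ℕ} → Digraph (Fin n) → (X : Subset n) → Digraph (Σ (Fin n) (_∈ₛ X))
G [ X ] = record
  { E      = λ u v → E G (proj₁ u) (proj₁ v)
  ; E?     = λ u v → E? G (proj₁ u) (proj₁ v)
  ; noLoop = λ v → noLoop G (proj₁ v)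
  }

NontrivialOn : ℕ → DigraphProperty → Set₁
NontrivialOn k Ψ =
  (Σ (Digraph (Fin k)) λ G → NoAntiparallel G × Ψ G) ×
  (Σ (Digraph (Fin k)) λ G → NoAntiparallel G × ¬ Ψ G)

HasCardinality : {A : Set} → (A → Set) → ℕ → Set
HasCardinality {A} P N =
  Σ (List A) λ xs → Unique xs × (∀ x → x ∈ xs ⇔ P x) × length xs ≡ N

------------------------------------------------------------------------
-- Random access machines: one memory of natural numbers, initially all 0,
-- a sequential input tape and an output tape, and unit cost per
-- instruction.

-- # c is the constant c, reg i the content of cell i, and ind i the
-- content of the cell whose address is stored in cell i.
data Operand : Set where
  #_  : ℕ → Operand
  reg : ℕ → Operand
  ind : ℕ → Operand

data Target : Set where
  reg : ℕ → Target
  ind : ℕ → Target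

data Instr : Set where
  move                : Target → Operand → Instr
  add sub mul div     : Target → Operand → Operand → Instr
  read                : Target → Instr
  write               : Operand → Instr
  jump                : ℕ → Instr
  jumpIfZero          : Operand → ℕ → Instr
  halt                : Instr

Program : Set
Program = List Instr

Memory : Set
Memory = ℕ → ℕ

record State : Set where
  constructor ⟨_,_,_,_⟩
  field
    pc     : ℕ
    memory : Memory
    input  : List ℕ
    output : List ℕ

open State public

value : Memory → Operand → ℕ
value m (# c)   = c
value m (reg i) = m i
value m (ind i) = m (m i)

address : Memory → Target → ℕ
address m (reg i) = i
address m (ind i) = m i

store : Memory → Target → ℕ → Memory
store m t v j = if j ≡ᵇ address m t then v else m j

quot : ℕ → ℕ → ℕ
quot a zero    = 0
quot a (suc b) = a / suc b

fetch : Program → ℕ → Instr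
fetch []      _       = halt
fetch (i ∷ _) zero    = i
fetch (_ ∷ P) (suc l) = fetch P l

exec : Instr → State → Maybe State
exec (move t a)  ⟨ l , m , is , os ⟩ = just ⟨ suc l , store m t (value m a) , is , os ⟩
exec (add t a b) ⟨ l , m , is , os ⟩ = just ⟨ suc l , store m t (value m a + value m b) , is , os ⟩
exec (sub t a b) ⟨ l , m , is , os ⟩ = just ⟨ suc l , store m t (value m a ∸ value m b) , is , os ⟩
exec (mul t a b) ⟨ l , m , is , os ⟩ = just ⟨ suc l , store m t (value m a * value m b) , is , os ⟩
exec (div t a b) ⟨ l , m , is , os ⟩ = just ⟨ suc l , store m t (quot (value m a) (value m b)) , is , os ⟩
exec (read t) ⟨ l , m , []     , os ⟩ = just ⟨ suc l , store m t 0 , [] , os ⟩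
exec (read t) ⟨ l , m , i ∷ is , os ⟩ = just ⟨ suc l , store m t i , is , os ⟩
exec (write a) ⟨ l , m , is , os ⟩ = just ⟨ suc l , m , is , os ++ (value m a ∷ []) ⟩
exec (jump l′) ⟨ l , m , is , os ⟩ = just ⟨ l′ , m , is , os ⟩
exec (jumpIfZero a l′) ⟨ l , m , is , os ⟩ =
  just ⟨ (if value m a ≡ᵇ 0 then l′ else suc l) , m , is , os ⟩
exec halt s = nothing

step : Program → State → Maybe State
step P s = exec (fetch P (pc s)) s

initial : List ℕ → State
initial is = ⟨ 0 , (λ _ → 0) , is , [] ⟩

-- Halts P W s t os: started in s, P halts after exactly t instructions
-- with os on the output tape, and no cell ever holds a number above W.
data Halts (P : Program) (W : ℕ) : State → ℕ → List ℕ → Set where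
  stop : ∀ {s} → (∀ i → memory s i ≤ W) → step P s ≡ nothing →
         Halts P W s 0 (output s)
  next : ∀ {s s′ t os} → (∀ i → memory s i ≤ W) → step P s ≡ just s′ →
         Halts P W s′ t os → Halts P W s (suc t) os

------------------------------------------------------------------------
-- Problems and linear time

record Problem : Set₂ where
  field
    Instance : Set₁
    encode   : Instance → List ℕ
    size     : Instance → ℕ
    Answer   : Instance → ℕ → Set

-- Unit cost is only meaningful for words of restricted length.  Here
-- words have O(log N) bits, N = size + largest input number + answer:
-- enough to hold addresses, the input numbers and the answer, and no more
-- up to a constant factor.
LinearTime : Problem → Set₁
LinearTime Q =
  ∃[ P ] ∃[ c ] ((x : Instance) → ∃[ y ] ∃[ t ]
    ( Answer x y
    × Halts P ((2 + size x + foldr _⊔_ 0 (encode x) + y) ^ c) (initial (encode x)) t (y ∷ [])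
    × t ≤ c * (1 + size x)))
  where open Problem Q

-- The out-neighbours of each vertex are listed in arbitrary order.
record AdjacencyLists {n : ℕ} (G : Digraph (Fin n)) : Set where
  field
    out      : Fin n → List (Fin n)
    unique   : ∀ u → Unique (out u)
    complete : ∀ u v → v ∈ out u ⇔ E G u v

  edgeCount : ℕ
  edgeCount = sum (map (λ u → length (out u)) (allFin n))

  encodeGraph : List ℕ
  encodeGraph = concatMap (λ u → length (out u) ∷ map toℕ (out u)) (allFin n)

record CountingInstance : Set₁ where
  field
    n              : ℕ
    G              : Digraph (Fin n)
    noAntiparallel : NoAntiparallel G
    lists          : AdjacencyLists G
    k              : ℕ

-- Given G and k, count the k-element X ⊆ V(G) such that G[X] satisfies Ψ.
#IndSub : DigraphProperty → Problem
#IndSub Ψ = record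
  { Instance = CountingInstance
  ; encode   = λ x → let open CountingInstance x in
                 n ∷ k ∷ AdjacencyLists.encodeGraph lists
  ; size     = λ x → let open CountingInstance x in
                 n + AdjacencyLists.edgeCount lists
  ; Answer   = λ x → let open CountingInstance x in
                 HasCardinality (λ X → ∣ X ∣ ≡ k × Ψ (G [ X ]))
  }

{-# OPTIONS --safe #-}
module Submission where

-- Without antiparallel edges a sink is unique, so the k-sets X for which
-- G[X] has a sink are obtained by choosing the sink v and k - 1 of its
-- in-neighbours: their number is the sum of C(indeg v, k - 1) over all v.
-- The machine reads the edges once and keeps, for every vertex, the number d
-- of in-edges seen so far and C(d, j) for j = k - 1, updated at each edge by
-- C(d + 1, j) = C(d, j) (d + 1) / (d + 1 - j).  The updates never decrease
-- these values nor their sum, which bounds all of them by the answer.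

open import Data.Bool using (Bool; true; false; if_then_else_)
open import Data.Empty using (⊥)
open import Data.Fin using (Fin; zero; suc; toℕ)
import Data.Fin.Properties as Fin
open import Data.Fin.Subset using (Subset; Side; inside; outside; ∣_∣) renaming (_∈_ to _∈ₛ_)
open import Data.List using (List; []; _∷_; _++_; length; map; concat; concatMap; foldl; foldr; tabulate; allFin)
open import Data.List.Membership.Propositional using (_∈_; _∉_)
open import Data.List.Membership.Propositional.Properties using (∈-map⁺; ∈-map⁻; ∈-++⁺ˡ; ∈-++⁺ʳ; ∈-++⁻; ∈-concat⁺; ∈-concat⁻)
open import Data.List.Properties using (length-map; length-++; length-tabulate)
import Data.List.Relation.Unary.All as All
import Data.List.Relation.Unary.All.Properties as All
open import Data.List.Relation.Unary.AllPairs using ([]; _∷_)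
import Data.List.Relation.Unary.AllPairs.Properties as AllPairs
open import Data.List.Relation.Unary.Any using (here; there)
import Data.List.Relation.Unary.Any.Properties as Any
open import Data.List.Relation.Unary.Unique.Propositional using (Unique)
import Data.List.Relation.Unary.Unique.Propositional.Properties as Unique
open import Data.Maybe using (just)
open import Data.Nat
open import Data.Nat.Combinatorics using (_C_; nCn≡1; nC1≡n; nCk≡nC[n∸k]; k>n⇒nCk≡0; nCk+nC[k+1]≡[n+1]C[k+1])
open import Data.Nat.DivMod using (0/n≡0; m*n/n≡m; m/n≤m)
open import Data.Nat.ListAction using (sum)
open import Data.Nat.Properties
open import Data.Nat.Tactic.RingSolver using (solve-∀)
open import Data.Product using (Σ; _×_; _,_; proj₁; proj₂; map₂)
open import Data.Sum using (inj₁; inj₂)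
open import Data.Vec using ([]; _∷_; lookup)
open import Data.Vec.Functional using (updateAt)
open import Data.Vec.Functional.Properties using (updateAt-updates; updateAt-minimal)
open import Data.Vec.Properties using (∷-injectiveʳ; []=⇒lookup; lookup⇒[]=)
open import Data.Vec.Properties.WithK using ([]=-irrelevant)
open import Function using (_∘_)
open import Function.Bundles using (mk⇔; Equivalence)
open import Relation.Binary.Definitions using (Tri; tri<; tri≈; tri>)
open import Relation.Binary.PropositionalEquality hiding ([_])
open import Relation.Nullary using (¬_; Dec; yes; no; contradiction)
open import Relation.Nullary.Decidable using (dec-true; dec-false; ¬?; _×-dec_)
open import Algebra.Properties.Monoid.Sum +-0-monoid using (sum-cong-≗) renaming (sum to ∑)
open import Defs

-- The obstacle is the word length: cells may only hold numbers polynomial in the input and the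
-- answer. Evaluating C(d, j) by raising the lower index passes through C(d, i) with i < j, which
-- can be exponentially larger than the result (C(d, d) = 1), and factorials have the same defect.
-- Keeping j fixed and letting d grow avoids this; the one oversized number is the product C(d, j)
-- (d + 1) formed before the division, which is quadratic in the bound. The recurrence has two gaps.
-- At d + 1 = j it reads 0 / 0 although C(j, j) = 1, so a correction computed by truncated
-- subtraction is added. For j = 0 the starting value would have to be 1, while memory starts at 0;
-- all these missing ones amount to n and go into the count at the beginning. Since k = 0 and k = 1
-- both give `k ∸ 1 = 0`, but have the answers 0 and n, this initial count must tell them apart.

private
  variable
    order : ℕ

-- Sums

∑-const : ∀ n c → ∑ {n} (λ _ → c) ≡ n * c
∑-const zero    c = refl
∑-const (suc n) c = cong (c +_) (∑-const n c)

∑-mono-≤ : {f g : Fin order → ℕ} → (∀ v → f v ≤ g v) → ∑ f ≤ ∑ g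
∑-mono-≤ {zero}  f≤g = z≤n
∑-mono-≤ {suc n} f≤g = +-mono-≤ (f≤g zero) (∑-mono-≤ (f≤g ∘ suc))

term≤∑ : (f : Fin order → ℕ) (v : Fin order) → f v ≤ ∑ f
term≤∑ f zero    = m≤m+n _ _
term≤∑ f (suc v) = ≤-trans (term≤∑ (f ∘ suc) v) (m≤n+m _ (f zero))

-- Additions on both sides keep truncated subtraction out; this form serves both the running count
-- and the count of forced vertices.
∑-update : {f g : Fin order → ℕ} (v : Fin order) → (∀ u → u ≢ v → g u ≡ f u) →
           ∑ g + f v ≡ ∑ f + g v
∑-update {f = f} {g} zero same = begin
  g zero + ∑ (g ∘ suc) + f zero    ≡⟨ +-comm _ (f zero) ⟩
  f zero + (g zero + ∑ (g ∘ suc))  ≡⟨ cong (f zero +_) (+-comm (g zero) _) ⟩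
  f zero + (∑ (g ∘ suc) + g zero)  ≡⟨ cong (λ s → f zero + (s + g zero)) (sum-cong-≗ (λ u → same (suc u) λ ())) ⟩
  f zero + (∑ (f ∘ suc) + g zero)  ≡⟨ +-assoc (f zero) _ _ ⟨
  f zero + ∑ (f ∘ suc) + g zero    ∎
  where open ≡-Reasoning
∑-update {f = f} {g} (suc v) same = begin
  g zero + ∑ (g ∘ suc) + f (suc v)    ≡⟨ +-assoc (g zero) _ _ ⟩
  g zero + (∑ (g ∘ suc) + f (suc v))  ≡⟨ cong₂ _+_ (same zero λ ()) (∑-update v (λ u u≢v → same (suc u) (u≢v ∘ Fin.suc-injective))) ⟩
  f zero + (∑ (f ∘ suc) + g (suc v))  ≡⟨ +-assoc (f zero) _ _ ⟨
  f zero + ∑ (f ∘ suc) + g (suc v)    ∎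
  where open ≡-Reasoning

length-concat-tabulate : {A : Set} (f : Fin order → List A) →
                         length (concat (tabulate f)) ≡ ∑ (length ∘ f)
length-concat-tabulate {zero}  f = refl
length-concat-tabulate {suc n} f =
  trans (length-++ (f zero)) (cong (length (f zero) +_) (length-concat-tabulate (f ∘ suc)))

-- Binomial coefficients

nC0≡1 : ∀ n → n C 0 ≡ 1
nC0≡1 n = trans (nCk≡nC[n∸k] {0} {n} z≤n) (nCn≡1 n)

nCk-mono : ∀ n k → n C k ≤ suc n C k
nCk-mono n zero    = ≤-reflexive (trans (nC0≡1 n) (sym (nC0≡1 (suc n))))
nCk-mono n (suc k) = subst (n C suc k ≤_) (nCk+nC[k+1]≡[n+1]C[k+1] n k) (m≤n+m _ (n C k))

-- The absorption identity, by induction on `n`: Pascal's rule splits the left side, one copy of `c`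
-- is set aside, the hypothesis applies to both remaining products, and Pascal's rule merges them
-- again.
[k+1]*[n+1]C[k+1]≡[n+1]*nCk : ∀ n k → suc k * (suc n C suc k) ≡ suc n * (n C k)
[k+1]*[n+1]C[k+1]≡[n+1]*nCk zero zero = refl
[k+1]*[n+1]C[k+1]≡[n+1]*nCk zero (suc k) = begin
  (2 + k) * (1 C (2 + k))  ≡⟨ cong ((2 + k) *_) (k>n⇒nCk≡0 {1} (s≤s (s≤s (z≤n {k})))) ⟩
  (2 + k) * 0              ≡⟨ *-zeroʳ (2 + k) ⟩
  0                        ≡⟨ cong (1 *_) (k>n⇒nCk≡0 {0} {suc k} (s≤s z≤n)) ⟨
  1 * (0 C suc k)          ∎
  where open ≡-Reasoning
[k+1]*[n+1]C[k+1]≡[n+1]*nCk (suc n) zero = begin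
  1 * ((2 + n) C 1)        ≡⟨ *-identityˡ _ ⟩
  (2 + n) C 1              ≡⟨ nC1≡n (2 + n) ⟩
  2 + n                    ≡⟨ *-identityʳ _ ⟨
  (2 + n) * 1              ≡⟨ cong ((2 + n) *_) (nC0≡1 (suc n)) ⟨
  (2 + n) * (suc n C 0)    ∎
  where open ≡-Reasoning
[k+1]*[n+1]C[k+1]≡[n+1]*nCk (suc n) (suc k) = begin
  (2 + k) * ((2 + n) C (2 + k))
    ≡⟨ cong ((2 + k) *_) (nCk+nC[k+1]≡[n+1]C[k+1] (suc n) (suc k)) ⟨
  (2 + k) * (c + (suc n C (2 + k)))
    ≡⟨ *-distribˡ-+ (2 + k) c _ ⟩
  c + suc k * c + (2 + k) * (suc n C (2 + k))
    ≡⟨ cong₂ (λ a b → c + a + b) ([k+1]*[n+1]C[k+1]≡[n+1]*nCk n k) ([k+1]*[n+1]C[k+1]≡[n+1]*nCk n (suc k)) ⟩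
  c + suc n * (n C k) + suc n * (n C suc k)
    ≡⟨ +-assoc c _ _ ⟩
  c + (suc n * (n C k) + suc n * (n C suc k))
    ≡⟨ cong (c +_) (*-distribˡ-+ (suc n) (n C k) _) ⟨
  c + suc n * (n C k + n C suc k)
    ≡⟨ cong (λ a → c + suc n * a) (nCk+nC[k+1]≡[n+1]C[k+1] n k) ⟩
  (2 + n) * c
    ∎
  where
  open ≡-Reasoning
  c = suc n C suc k

-- Read `n ∸ k` as `suc n ∸ suc k`; after absorption, Pascal's rule cancels `n C k`. This is what
-- makes the division in `nextBinom` exact.
[n∸k]*[n+1]C[k+1]≡nC[k+1]*[n+1] : ∀ n k → (n ∸ k) * (suc n C suc k) ≡ (n C suc k) * suc n
[n∸k]*[n+1]C[k+1]≡nC[k+1]*[n+1] n k = begin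
  (n ∸ k) * c                                                    ≡⟨ *-distribʳ-∸ c (suc n) (suc k) ⟩
  suc n * c ∸ suc k * c                                          ≡⟨ cong (suc n * c ∸_) ([k+1]*[n+1]C[k+1]≡[n+1]*nCk n k) ⟩
  suc n * c ∸ suc n * (n C k)                                    ≡⟨ *-distribˡ-∸ (suc n) c (n C k) ⟨
  suc n * (c ∸ n C k)                                            ≡⟨ cong (λ a → suc n * (a ∸ n C k)) (nCk+nC[k+1]≡[n+1]C[k+1] n k) ⟨
  suc n * (n C k + n C suc k ∸ n C k)                            ≡⟨ cong (suc n *_) (m+n∸m≡n (n C k) _) ⟩
  suc n * (n C suc k)                                            ≡⟨ *-comm (suc n) _ ⟩
  (n C suc k) * suc n                                            ∎
  where
  open ≡-Reasoning
  c = suc n C suc k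

-- nextBinom j d b is C(d + 1, j) if b = C(d, j) and j > 0; the second
-- summand is 1 if d + 1 = j and 0 otherwise.
nextBinom : ℕ → ℕ → ℕ → ℕ
nextBinom j d b = quot (b * suc d) (suc d ∸ j) + (1 ∸ ((j ∸ suc d) + (suc d ∸ j)))

-- C(d, j) for j > 0, but binom 0 d = 0.
binom : ℕ → ℕ → ℕ
binom j zero    = 0
binom j (suc d) = nextBinom j d (binom j d)

quot-≤ : ∀ a b → quot a b ≤ a
quot-≤ a zero    = z≤n
quot-≤ a (suc b) = m/n≤m a (suc b)

-- Below the diagonal the divisor truncates to 0 and `quot` returns 0; on it the correction supplies
-- C(j, j) = 1; above it the division is exact and the correction vanishes.
nextBinom-C : ∀ i d → nextBinom (suc i) d (d C suc i) ≡ suc d C suc i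
nextBinom-C i d = go (<-cmp d i)
  where
  open ≡-Reasoning
  x = (d C suc i) * suc d
  go : Tri (d < i) (d ≡ i) (i < d) → quot x (d ∸ i) + (1 ∸ ((i ∸ d) + (d ∸ i))) ≡ suc d C suc i
  go (tri< d<i _ _) = begin
    quot x (d ∸ i) + (1 ∸ ((i ∸ d) + (d ∸ i)))  ≡⟨ cong₂ (λ e f → quot x e + f) (m≤n⇒m∸n≡0 (<⇒≤ d<i)) (m≤n⇒m∸n≡0 (m≤n⇒m≤n+o _ (m<n⇒0<n∸m d<i))) ⟩
    0                                           ≡⟨ k>n⇒nCk≡0 (s≤s d<i) ⟨
    suc d C suc i                               ∎
  go (tri≈ _ refl _) = begin
    quot x (d ∸ d) + (1 ∸ ((d ∸ d) + (d ∸ d)))  ≡⟨ cong (λ e → quot x e + (1 ∸ (e + e))) (n∸n≡0 d) ⟩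
    1                                           ≡⟨ nCn≡1 (suc d) ⟨
    suc d C suc d                               ∎
  go (tri> _ _ i<d) = exact (d ∸ i) (suc d C suc i) (m<n⇒0<n∸m i<d) ([n∸k]*[n+1]C[k+1]≡nC[k+1]*[n+1] d i)
    where
    exact : ∀ e c → 0 < e → e * c ≡ x → quot x e + (1 ∸ ((i ∸ d) + e)) ≡ c
    exact (suc e) c _ eq = begin
      x / suc e + (1 ∸ ((i ∸ d) + suc e))       ≡⟨ cong₂ _+_ (cong (_/ suc e) (trans (sym eq) (*-comm (suc e) c))) (m≤n⇒m∸n≡0 (m≤n⇒m≤o+n (i ∸ d) (s≤s z≤n))) ⟩
      c * suc e / suc e + 0                     ≡⟨ +-identityʳ _ ⟩
      c * suc e / suc e                         ≡⟨ m*n/n≡m c (suc e) ⟩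
      c                                         ∎

-- For j = 0 the correction never fires, as d + 1 > 0, so a cell that starts at 0 stays there.
binom-0 : ∀ d → binom 0 d ≡ 0
binom-0 zero    = refl
binom-0 (suc d) = trans (cong (nextBinom 0 d) (binom-0 d)) (cong₂ _+_ (0/n≡0 (suc d)) (0∸n≡0 d))

binom-suc : ∀ i d → binom (suc i) d ≡ d C suc i
binom-suc i zero    = sym (k>n⇒nCk≡0 {0} {suc i} (s≤s z≤n))
binom-suc i (suc d) = trans (cong (nextBinom (suc i) d) (binom-suc i d)) (nextBinom-C i d)

binom-step : ∀ j d → binom j d ≤ binom j (suc d)
binom-step zero    d = ≤-trans (≤-reflexive (binom-0 d)) z≤n
binom-step (suc i) d = subst₂ _≤_ (sym (binom-suc i d)) (sym (binom-suc i (suc d))) (nCk-mono d (suc i))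

-- Subsets with prescribed and forbidden elements

-- For a fixed candidate sink, the sink itself will be `must`, its in-neighbours `may` and every
-- other vertex `mustNot`.
data Role : Set where
  must may mustNot : Role

data _Allows_ : Role → Side → Set where
  must    : must Allows inside
  may     : ∀ {s} → may Allows s
  mustNot : mustNot Allows outside

Respects : (Fin order → Role) → Subset order → Set
Respects c X = ∀ u → c u Allows lookup X u

withFirst withoutFirst : (ℕ → List (Subset order)) → ℕ → List (Subset (suc order))
withFirst S zero    = []
withFirst S (suc k) = map (inside ∷_) (S k)
withoutFirst S k    = map (outside ∷_) (S k)

extend : Role → (ℕ → List (Subset order)) → ℕ → List (Subset (suc order))
extend must    S k = withFirst S k
extend may     S k = withFirst S k ++ withoutFirst S k
extend mustNot S k = withoutFirst S k

subsets : (Fin order → Role) → ℕ → List (Subset order)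
subsets {zero}  c zero    = [] ∷ []
subsets {zero}  c (suc k) = []
subsets {suc n} c k       = extend (c zero) (subsets (c ∘ suc)) k

∈-subsets⁺ : (c : Fin order → Role) (X : Subset order) → Respects c X → X ∈ subsets c ∣ X ∣
∈-subsets⁺ c [] ok = here refl
∈-subsets⁺ c (s ∷ X) ok = go (c zero) s (ok zero)
  where
  S = subsets (c ∘ suc)
  X∈S = ∈-subsets⁺ (c ∘ suc) X (ok ∘ suc)
  go : ∀ r s → r Allows s → s ∷ X ∈ extend r S ∣ s ∷ X ∣
  go must    inside  _ = ∈-map⁺ (inside ∷_) X∈S
  go may     inside  _ = ∈-++⁺ˡ (∈-map⁺ (inside ∷_) X∈S)
  go may     outside _ = ∈-++⁺ʳ (withFirst S ∣ X ∣) (∈-map⁺ (outside ∷_) X∈S)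
  go mustNot outside _ = ∈-map⁺ (outside ∷_) X∈S

∈-withFirst⁻ : (S : ℕ → List (Subset order)) {k : ℕ} {s : Side} {X : Subset order} →
               s ∷ X ∈ withFirst S k → s ≡ inside × Σ ℕ λ l → k ≡ suc l × X ∈ S l
∈-withFirst⁻ S {suc k} p with _ , q , refl ← ∈-map⁻ (inside ∷_) p = refl , k , refl , q

∈-withoutFirst⁻ : (S : ℕ → List (Subset order)) {k : ℕ} {s : Side} {X : Subset order} →
                  s ∷ X ∈ withoutFirst S k → s ≡ outside × X ∈ S k
∈-withoutFirst⁻ S p with _ , q , refl ← ∈-map⁻ (outside ∷_) p = refl , q

∈-subsets⁻ : (c : Fin order → Role) {k : ℕ} (X : Subset order) → X ∈ subsets c k → ∣ X ∣ ≡ k × Respects c X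
∈-subsets⁻ c {zero} [] p = refl , λ ()
∈-subsets⁻ {suc n} c {k} (s ∷ X) p =
  let eq , allowed , rest = go (c zero) p in
  eq , λ where
    zero    → allowed
    (suc u) → rest u
  where
  S = subsets (c ∘ suc)
  first : ∀ r → r Allows inside → s ∷ X ∈ withFirst S k →
          ∣ s ∷ X ∣ ≡ k × r Allows s × Respects (c ∘ suc) X
  first r ok p with refl , l , refl , q ← ∈-withFirst⁻ S {k} p =
    let eq , rest = ∈-subsets⁻ (c ∘ suc) X q in cong suc eq , ok , rest
  noFirst : ∀ r → r Allows outside → s ∷ X ∈ withoutFirst S k →
            ∣ s ∷ X ∣ ≡ k × r Allows s × Respects (c ∘ suc) X
  noFirst r ok p with refl , q ← ∈-withoutFirst⁻ S {k} p =
    let eq , rest = ∈-subsets⁻ (c ∘ suc) X q in eq , ok , rest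
  go : ∀ r → s ∷ X ∈ extend r S k → ∣ s ∷ X ∣ ≡ k × r Allows s × Respects (c ∘ suc) X
  go must    p = first must must p
  go mustNot p = noFirst mustNot mustNot p
  go may     p with ∈-++⁻ (withFirst S k) p
  ... | inj₁ q = first may may q
  ... | inj₂ q = noFirst may may q

subsets-unique : (c : Fin order → Role) (k : ℕ) → Unique (subsets c k)
subsets-unique {zero}  c zero    = All.[] ∷ []
subsets-unique {zero}  c (suc k) = []
subsets-unique {suc n} c k       = go (c zero)
  where
  S = subsets (c ∘ suc)
  first : ∀ k → Unique (withFirst S k)
  first zero    = []
  first (suc k) = Unique.map⁺ ∷-injectiveʳ (subsets-unique (c ∘ suc) k)
  noFirst : Unique (withoutFirst S k)
  noFirst = Unique.map⁺ ∷-injectiveʳ (subsets-unique (c ∘ suc) k)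
  go : ∀ r → Unique (extend r S k)
  go must    = first k
  go mustNot = noFirst
  go may     = Unique.++⁺ (first k) noFirst disjoint
    where
    disjoint : ∀ {X} → ¬ (X ∈ withFirst S k × X ∈ withoutFirst S k)
    disjoint {s ∷ X} (p , q) with refl , _ ← ∈-withFirst⁻ S {k} p | () , _ ← ∈-withoutFirst⁻ S {k} q

isMust isMay : Role → ℕ
isMust must    = 1
isMust may     = 0
isMust mustNot = 0
isMay  must    = 0
isMay  may     = 1
isMay  mustNot = 0

-- The number of k-element sets that contain a given elements and have
-- their other elements among b given ones.
choices : ℕ → ℕ → ℕ → ℕ
choices zero    b k       = b C k
choices (suc a) b zero    = 0
choices (suc a) b (suc k) = choices a b k

choices-suc-0 : ∀ a b → choices a (suc b) 0 ≡ choices a b 0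
choices-suc-0 zero    b = trans (nC0≡1 (suc b)) (sym (nC0≡1 b))
choices-suc-0 (suc a) b = refl

-- Pascal's rule once the forced elements have been stripped off; if `k` runs out first, only
-- `choices-suc-0` is left to show.
choices-suc-suc : ∀ a b k → choices a (suc b) (suc k) ≡ choices a b k + choices a b (suc k)
choices-suc-suc zero    b k       = sym (nCk+nC[k+1]≡[n+1]C[k+1] b k)
choices-suc-suc (suc a) b zero    = choices-suc-0 a b
choices-suc-suc (suc a) b (suc k) = choices-suc-suc a b k

-- A `may` element splits the sets into those with it and those without it, which is Pascal's rule;
-- the other roles only shift the parameters.
length-subsets : (c : Fin order → Role) (k : ℕ) →
                 length (subsets c k) ≡ choices (∑ (isMust ∘ c)) (∑ (isMay ∘ c)) k
length-subsets {zero}  c zero    = refl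
length-subsets {zero}  c (suc k) = sym (k>n⇒nCk≡0 {0} {suc k} (s≤s z≤n))
length-subsets {suc n} c k       = go (c zero) k
  where
  S = subsets (c ∘ suc)
  a = ∑ (isMust ∘ c ∘ suc)
  b = ∑ (isMay ∘ c ∘ suc)
  S-length : ∀ s k → length (map (s ∷_) (S k)) ≡ choices a b k
  S-length s k = trans (length-map (s ∷_) (S k)) (length-subsets (c ∘ suc) k)
  go : ∀ r k → length (extend r S k) ≡ choices (isMust r + a) (isMay r + b) k
  go must    zero    = refl
  go must    (suc k) = S-length inside k
  go mustNot k       = S-length outside k
  go may     zero    = trans (S-length outside 0) (sym (choices-suc-0 a b))
  go may     (suc k) = begin
    length (map (inside ∷_) (S k) ++ map (outside ∷_) (S (suc k)))  ≡⟨ length-++ (map (inside ∷_) (S k)) ⟩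
    length (map (inside ∷_) (S k)) + length (map (outside ∷_) (S (suc k)))  ≡⟨ cong₂ _+_ (S-length inside k) (S-length outside (suc k)) ⟩
    choices a b k + choices a b (suc k)  ≡⟨ choices-suc-suc a b k ⟨
    choices a (suc b) (suc k)  ∎
    where open ≡-Reasoning

-- Subsets inducing a graph with a sink

module Counting {n : ℕ} (G : Digraph (Fin n)) where

  roleOf : {u v : Fin n} → Dec (E G u v) → Dec (u ≡ v) → Role
  roleOf (yes _) _       = may
  roleOf (no _)  (yes _) = must
  roleOf (no _)  (no _)  = mustNot

  role : Fin n → Fin n → Role
  role v u = roleOf (E? G u v) (u Fin.≟ v)

  role-self : ∀ v → role v v ≡ must
  role-self v with E? G v v | v Fin.≟ v
  ... | yes e | _       = contradiction e (noLoop G v)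
  ... | no _  | yes _   = refl
  ... | no _  | no v≢v = contradiction refl v≢v

  -- Sinks of `G [ X ]` in terms of vertices of `G`, so that vertices are compared without their
  -- membership proofs.
  SinkOn : Subset n → Fin n → Set
  SinkOn X v = v ∈ₛ X × (∀ u → u ∈ₛ X → u ≢ v → E G u v)

  SinkOn⇒Respects : ∀ X v → SinkOn X v → Respects (role v) X
  SinkOn⇒Respects X v (v∈X , edge) u with E? G u v | u Fin.≟ v | lookup X u in eq
  ... | yes _ | _        | _       = may
  ... | no _  | yes refl | s       = subst (must Allows_) (trans (sym ([]=⇒lookup v∈X)) eq) must
  ... | no ¬e | no u≢v   | inside  = contradiction (edge u (lookup⇒[]= u X eq) u≢v) ¬e
  ... | no _  | no _     | outside = mustNot

  Respects⇒SinkOn : ∀ X v → Respects (role v) X → SinkOn X v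
  Respects⇒SinkOn X v ok = lookup⇒[]= v X (must-inside (subst (_Allows lookup X v) (role-self v) (ok v))) , edge
    where
    must-inside : ∀ {s} → must Allows s → s ≡ inside
    must-inside must = refl
    edge : ∀ u → u ∈ₛ X → u ≢ v → E G u v
    edge u u∈X u≢v with E? G u v | u Fin.≟ v | subst (role v u Allows_) ([]=⇒lookup u∈X) (ok u)
    ... | yes e | _       | _ = e
    ... | no _  | yes u≡v | _ = contradiction u≡v u≢v
    ... | no _  | no _    | ()

  Ψsink⇒SinkOn : ∀ X → Ψsink (G [ X ]) → Σ (Fin n) (SinkOn X)
  Ψsink⇒SinkOn X ((v , v∈X) , sink) = v , v∈X , λ u u∈X u≢v → sink (u , u∈X) (u≢v ∘ cong proj₁)

  SinkOn⇒Ψsink : ∀ X v → SinkOn X v → Ψsink (G [ X ])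
  SinkOn⇒Ψsink X v (v∈X , edge) = (v , v∈X) , λ where
    -- Membership proofs are irrelevant, so vertices of `G [ X ]` are equal as soon as their first
    -- components are.
    (u , u∈X) u≢v → edge u u∈X λ where refl → u≢v (cong (v ,_) ([]=-irrelevant u∈X v∈X))

  indegree : Fin n → ℕ
  indegree v = ∑ (isMay ∘ role v)

  -- The indicator of `must` agrees with the zero function away from `v`, so `∑-update` compares
  -- their sums.
  one-must : ∀ v → ∑ (isMust ∘ role v) ≡ 1
  one-must v = begin
    ∑ (isMust ∘ role v)                    ≡⟨ +-identityʳ _ ⟨
    ∑ (isMust ∘ role v) + 0                ≡⟨ ∑-update v others ⟩
    ∑ {n} (λ _ → 0) + isMust (role v v)    ≡⟨ cong₂ _+_ (trans (∑-const n 0) (*-zeroʳ n)) (cong isMust (role-self v)) ⟩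
    1                                      ∎
    where
    open ≡-Reasoning
    others : ∀ u → u ≢ v → isMust (role v u) ≡ 0
    others u u≢v with E? G u v | u Fin.≟ v
    ... | yes _ | _       = refl
    ... | no _  | yes u≡v = contradiction u≡v u≢v
    ... | no _  | no _    = refl

  sinkSets-cardinality : NoAntiparallel G → ∀ k →
    HasCardinality (λ X → ∣ X ∣ ≡ k × Ψsink (G [ X ])) (∑ λ v → choices 1 (indegree v) k)
  sinkSets-cardinality noAnti k = concat (tabulate sets) , unique , (λ X → mk⇔ (to X) (from X)) , size
    where
    sets : Fin n → List (Subset n)
    sets v = subsets (role v) k

    -- Two different sinks of one set would be joined by edges in both directions.
    disjoint : ∀ {u v} → u ≢ v → ∀ {X} → ¬ (X ∈ sets u × X ∈ sets v)
    disjoint {u} {v} u≢v {X} (p , q) =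
      let u∈X , toU = Respects⇒SinkOn X u (proj₂ (∈-subsets⁻ (role u) X p))
          v∈X , toV = Respects⇒SinkOn X v (proj₂ (∈-subsets⁻ (role v) X q))
      in noAnti u v (toV u u∈X u≢v , toU v v∈X (u≢v ∘ sym))

    unique : Unique (concat (tabulate sets))
    unique = Unique.concat⁺ (All.tabulate⁺ λ v → subsets-unique (role v) k)
                            (AllPairs.tabulate⁺ λ u≢v → disjoint u≢v)

    to : ∀ X → X ∈ concat (tabulate sets) → ∣ X ∣ ≡ k × Ψsink (G [ X ])
    to X p =
      let v , q = Any.tabulate⁻ (∈-concat⁻ (tabulate sets) p)
          eq , ok = ∈-subsets⁻ (role v) X q
      in eq , SinkOn⇒Ψsink X v (Respects⇒SinkOn X v ok)

    from : ∀ X → ∣ X ∣ ≡ k × Ψsink (G [ X ]) → X ∈ concat (tabulate sets)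
    from X (refl , ψ) =
      let v , sink = Ψsink⇒SinkOn X ψ
      in ∈-concat⁺ (Any.tabulate⁺ v (∈-subsets⁺ (role v) X (SinkOn⇒Respects X v sink)))

    size : length (concat (tabulate sets)) ≡ ∑ λ v → choices 1 (indegree v) k
    size = trans (length-concat-tabulate sets)
      (sum-cong-≗ λ v → trans (length-subsets (role v) k)
                              (cong (λ a → choices a (indegree v) k) (one-must v)))

-- Random access machine programs

Bounded : ℕ → Memory → Set
Bounded W m = ∀ i → m i ≤ W

store-bounded : ∀ {W m} t {v} → Bounded W m → v ≤ W → Bounded W (store m t v)
store-bounded {m = m} t B v≤W i with i ≡ᵇ address m t
... | true  = v≤W
... | false = B i

-- One relation for the five arithmetic instructions lets a single rule `assign` serve them all.
-- With the value as an index, it can be given in terms of an earlier memory and is matched with the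
-- nested stores by computation.
data Assigns (m : Memory) : Instr → Target → ℕ → Set where
  move : ∀ {t a}   → Assigns m (move t a) t (value m a)
  add  : ∀ {t a b} → Assigns m (add t a b) t (value m a + value m b)
  sub  : ∀ {t a b} → Assigns m (sub t a b) t (value m a ∸ value m b)
  mul  : ∀ {t a b} → Assigns m (mul t a b) t (value m a * value m b)
  div  : ∀ {t a b} → Assigns m (div t a b) t (quot (value m a) (value m b))

module Steps (P : Program) (W : ℕ) where

  assign : ∀ {l m is os t T out} v → Assigns m (fetch P l) t v → Bounded W m → v ≤ W →
           (Bounded W (store m t v) → Halts P W ⟨ suc l , store m t v , is , os ⟩ T out) →
           Halts P W ⟨ l , m , is , os ⟩ (suc T) out
  assign {l} {m} {is} {os} {t} v A B v≤W rest =
    next B (executes A) (rest (store-bounded t B v≤W))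
    where
    executes : ∀ {i} → Assigns m i t v → exec i ⟨ l , m , is , os ⟩ ≡ just ⟨ suc l , store m t v , is , os ⟩
    executes move = refl
    executes add  = refl
    executes sub  = refl
    executes mul  = refl
    executes div  = refl

  readNext : ∀ {l m i is os t T out} → fetch P l ≡ read t → Bounded W m → i ≤ W →
             (Bounded W (store m t i) → Halts P W ⟨ suc l , store m t i , is , os ⟩ T out) →
             Halts P W ⟨ l , m , i ∷ is , os ⟩ (suc T) out
  readNext {l} {m} {i} {is} {os} {t} eq B i≤W rest =
    next B (cong (λ instr → exec instr ⟨ l , m , i ∷ is , os ⟩) eq) (rest (store-bounded t B i≤W))

  branch : ∀ {l m is os a l′ T out} (b : Bool) → fetch P l ≡ jumpIfZero a l′ → (value m a ≡ᵇ 0) ≡ b →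
           Bounded W m → Halts P W ⟨ (if b then l′ else suc l) , m , is , os ⟩ T out →
           Halts P W ⟨ l , m , is , os ⟩ (suc T) out
  branch {l} {m} {is} {os} b eq refl B rest =
    next B (cong (λ instr → exec instr ⟨ l , m , is , os ⟩) eq) rest

-- Cells: 0 vertices left, 1 k ∸ 1, 2 the count so far, 3 edges left at the
-- current vertex, 4-9 scratch; 10 + 2 v and 11 + 2 v hold the number d of
-- in-edges of v read so far and binom (k ∸ 1) d.
program : Program
program =
    read (reg 0)
  ∷ read (reg 1)
  -- `(1 ∸ k) + (k ∸ 1)` is the distance from k to 1, so cell 2 ends up as n if k = 1 and as 0
  -- otherwise.
  ∷ sub (reg 2) (# 1) (reg 1)
  ∷ sub (reg 1) (reg 1) (# 1)
  ∷ add (reg 2) (reg 2) (reg 1)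
  ∷ sub (reg 2) (# 1) (reg 2)
  ∷ mul (reg 2) (reg 2) (reg 0)
  -- 7: next vertex
  ∷ jumpIfZero (reg 0) 29
  ∷ sub (reg 0) (reg 0) (# 1)
  ∷ read (reg 3)
  -- 10: next edge
  ∷ jumpIfZero (reg 3) 7
  ∷ sub (reg 3) (reg 3) (# 1)
  ∷ read (reg 4)
  ∷ mul (reg 4) (# 2) (reg 4)
  ∷ add (reg 4) (# 10) (reg 4)
  ∷ add (reg 5) (# 1) (reg 4)
  ∷ add (reg 6) (# 1) (ind 4)
  -- Cell 7 is the divisor d + 1 ∸ j, and cell 8 becomes the correction that is 1 exactly if d + 1 =
  -- j.
  ∷ sub (reg 7) (reg 6) (reg 1)
  ∷ sub (reg 8) (reg 1) (reg 6)
  ∷ add (reg 8) (reg 8) (reg 7)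
  ∷ sub (reg 8) (# 1) (reg 8)
  ∷ mul (reg 9) (ind 5) (reg 6)
  ∷ div (reg 9) (reg 9) (reg 7)
  ∷ add (reg 9) (reg 9) (reg 8)
  -- The new value is added before the old one is removed, so that the subtraction does not
  -- truncate.
  ∷ add (reg 2) (reg 2) (reg 9)
  ∷ sub (reg 2) (reg 2) (ind 5)
  ∷ move (ind 4) (reg 6)
  ∷ move (ind 5) (reg 9)
  ∷ jump 10
  -- 29: no vertices left
  ∷ write (reg 2)
  ∷ halt
  ∷ []

-- `linear` makes room for the cell addresses and for sums of two numbers up to `N`, `quadratic` for
-- the product formed before the division.
record RoomFor (N W : ℕ) : Set where
  field
    linear    : 12 + 2 * N ≤ W
    quadratic : N * N ≤ W

module Run (N W : ℕ) (room : RoomFor N W) where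
  open RoomFor room
  open Steps program W

  N+N≤W : N + N ≤ W
  N+N≤W = ≤-trans (m≤n+m (N + N) 12) (subst (λ x → 12 + (N + x) ≤ W) (+-identityʳ N) linear)

  N≤W : N ≤ W
  N≤W = ≤-trans (m≤m+n N N) N+N≤W

  1≤W : 1 ≤ W
  1≤W = ≤-trans (s≤s z≤n) linear

  -- One pass of the edge loop takes 19 instructions, from the test to the jump back. The
  -- continuation gets an arbitrary `m′` with the listed equations, so nested stores do not pile up
  -- from edge to edge. The last equation tests the later store first, which is the form that
  -- lookups reduce to.
  edge-step : ∀ {m e is T out} → Bounded W m → m 3 ≢ 0 → e ≤ N →
    let j  = m 1
        d  = m (10 + 2 * e)
        b  = m (11 + 2 * e)
        b′ = nextBinom j d b
    in
    j ≤ N → m 2 ≤ N → suc d ≤ N → b ≤ N → b′ ≤ N →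
    (∀ m′ → Bounded W m′ → m′ 0 ≡ m 0 → m′ 1 ≡ j → m′ 2 ≡ (m 2 + b′) ∸ b → m′ 3 ≡ m 3 ∸ 1 →
      (∀ i → m′ (10 + i) ≡ (if i ≡ᵇ suc (2 * e) then b′ else if i ≡ᵇ 2 * e then suc d else m (10 + i))) →
      Halts program W ⟨ 10 , m′ , is , [] ⟩ T out) →
    Halts program W ⟨ 10 , m , e ∷ is , [] ⟩ (19 + T) out
  edge-step {m} {e} {is} B m3≢0 e≤N j≤N T≤N d<N b≤N b′≤N rest =
    branch false refl (dec-false (m 3 ≟ 0) m3≢0) B
    (assign (m 3 ∸ 1) sub B (≤-trans (m∸n≤m (m 3) 1) (B 3)) λ B →
    readNext refl B (≤-trans e≤N N≤W) λ B →
    assign (2 * e) mul B 2e≤W λ B →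
    assign (10 + 2 * e) add B 10+2e≤W λ B →
    assign (11 + 2 * e) add B 11+2e≤W λ B →
    assign (suc d) add B (≤-trans d<N N≤W) λ B →
    assign (suc d ∸ j) sub B (≤-trans (m∸n≤m _ j) (≤-trans d<N N≤W)) λ B →
    assign (j ∸ suc d) sub B (≤-trans (m∸n≤m j (suc d)) (≤-trans j≤N N≤W)) λ B →
    assign ((j ∸ suc d) + (suc d ∸ j)) add B (≤-trans (+-mono-≤ (≤-trans (m∸n≤m j (suc d)) j≤N) (≤-trans (m∸n≤m _ j) d<N)) N+N≤W) λ B →
    assign (1 ∸ ((j ∸ suc d) + (suc d ∸ j))) sub B (≤-trans (m∸n≤m 1 ((j ∸ suc d) + (suc d ∸ j))) 1≤W) λ B →
    assign (b * suc d) mul B product≤W λ B →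
    assign (quot (b * suc d) (suc d ∸ j)) div B (≤-trans (quot-≤ (b * suc d) (suc d ∸ j)) product≤W) λ B →
    assign b′ add B (≤-trans b′≤N N≤W) λ B →
    assign (m 2 + b′) add B sum≤W λ B →
    assign (m 2 + b′ ∸ b) sub B (≤-trans (m∸n≤m (m 2 + b′) b) sum≤W) λ B →
    assign (suc d) move B (≤-trans d<N N≤W) λ B →
    assign b′ move B (≤-trans b′≤N N≤W) λ B →
    next B refl (rest _ B refl refl refl refl (λ i → refl)))
    where
    j  = m 1
    d  = m (10 + 2 * e)
    b  = m (11 + 2 * e)
    b′ = nextBinom j d b
    12+2e≤W : 12 + 2 * e ≤ W
    12+2e≤W = ≤-trans (+-monoʳ-≤ 12 (*-monoʳ-≤ 2 e≤N)) linear
    11+2e≤W : 11 + 2 * e ≤ W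
    11+2e≤W = ≤-trans (n≤1+n _) 12+2e≤W
    10+2e≤W : 10 + 2 * e ≤ W
    10+2e≤W = ≤-trans (n≤1+n _) 11+2e≤W
    2e≤W : 2 * e ≤ W
    2e≤W = ≤-trans (m≤n+m (2 * e) 10) 10+2e≤W
    product≤W : b * suc d ≤ W
    product≤W = ≤-trans (*-mono-≤ b≤N d<N) quadratic
    sum≤W : m 2 + b′ ≤ W
    sum≤W = ≤-trans (+-mono-≤ T≤N b′≤N) N+N≤W

-- Reading the edges

module _ {n : ℕ} where

  addEdges : (Fin n → ℕ) → List (Fin n) → Fin n → ℕ
  addEdges = foldl (λ δ e → updateAt δ e suc)

  bump-≤ : ∀ δ (e v : Fin n) → updateAt δ e suc v ≤ suc (δ v)
  bump-≤ δ e v with v Fin.≟ e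
  ... | yes refl = ≤-reflexive (updateAt-updates e δ)
  ... | no v≢e   = ≤-trans (≤-reflexive (updateAt-minimal v e δ v≢e)) (n≤1+n _)

  addEdges-≤ : ∀ δ es v → addEdges δ es v ≤ δ v + length es
  addEdges-≤ δ []       v = m≤m+n (δ v) 0
  addEdges-≤ δ (e ∷ es) v = begin
    addEdges (updateAt δ e suc) es v   ≤⟨ addEdges-≤ (updateAt δ e suc) es v ⟩
    updateAt δ e suc v + length es     ≤⟨ +-monoˡ-≤ (length es) (bump-≤ δ e v) ⟩
    suc (δ v) + length es              ≡⟨ +-suc (δ v) (length es) ⟨
    δ v + suc (length es)              ∎
    where open ≤-Reasoning

  addEdges-∉ : ∀ δ {es v} → v ∉ es → addEdges δ es v ≡ δ v
  addEdges-∉ δ {[]}     v∉ = refl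
  addEdges-∉ δ {e ∷ es} v∉ =
    trans (addEdges-∉ _ (v∉ ∘ there)) (updateAt-minimal _ e δ (v∉ ∘ here))

  addEdges-∈ : ∀ δ {es v} → Unique es → v ∈ es → addEdges δ es v ≡ suc (δ v)
  addEdges-∈ δ {e ∷ es} (e∉es ∷ _) (here refl) =
    trans (addEdges-∉ _ (λ e∈es → All.lookup e∉es e∈es refl)) (updateAt-updates e δ)
  addEdges-∈ δ {e ∷ es} (e∉es ∷ uniq) (there v∈es) =
    trans (addEdges-∈ _ uniq v∈es)
          (cong suc (updateAt-minimal _ e δ (λ v≡e → All.lookup e∉es v∈es (sym v≡e))))

  module Lists (out : Fin n → List (Fin n)) where

    addVertices : (Fin n → ℕ) → List (Fin n) → Fin n → ℕ
    addVertices = foldl (λ δ u → addEdges δ (out u))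

    edgesOf : List (Fin n) → ℕ
    edgesOf us = sum (map (λ u → length (out u)) us)

    encodeLists : List (Fin n) → List ℕ
    encodeLists = concatMap (λ u → length (out u) ∷ map toℕ (out u))

-- The running count

module Totals {n : ℕ} (T₀ j : ℕ) where

  -- The content of cell 2 when `δ` gives the in-edges read so far; `T₀` is its initial content.
  total : (Fin n → ℕ) → ℕ
  total δ = T₀ + ∑ (λ v → binom j (δ v))

  total-bump : ∀ δ e → total (updateAt δ e suc) + binom j (δ e) ≡ total δ + binom j (suc (δ e))
  total-bump δ e = begin
    T₀ + ∑ (λ v → binom j (δ′ v)) + binom j (δ e)    ≡⟨ +-assoc T₀ _ _ ⟩
    T₀ + (∑ (λ v → binom j (δ′ v)) + binom j (δ e))  ≡⟨ cong (T₀ +_) (∑-update e (λ u u≢e → cong (binom j) (updateAt-minimal u e δ u≢e))) ⟩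
    T₀ + (∑ (λ v → binom j (δ v)) + binom j (δ′ e))  ≡⟨ +-assoc T₀ _ _ ⟨
    total δ + binom j (δ′ e)                         ≡⟨ cong (λ d → total δ + binom j d) (updateAt-updates e δ) ⟩
    total δ + binom j (suc (δ e))                    ∎
    where
    open ≡-Reasoning
    δ′ = updateAt δ e suc

  binom≤total : ∀ δ v → binom j (δ v) ≤ total δ
  binom≤total δ v = ≤-trans (term≤∑ (λ u → binom j (δ u)) v) (m≤n+m _ T₀)

  total-≤-bump : ∀ δ e → total δ ≤ total (updateAt δ e suc)
  total-≤-bump δ e = +-monoʳ-≤ T₀ (∑-mono-≤ grows)
    where
    grows : ∀ v → binom j (δ v) ≤ binom j (updateAt δ e suc v)
    grows v with v Fin.≟ e
    ... | yes refl = subst (λ d → binom j (δ e) ≤ binom j d) (sym (updateAt-updates e δ)) (binom-step j (δ e))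
    ... | no v≢e   = ≤-reflexive (cong (binom j) (sym (updateAt-minimal v e δ v≢e)))

  total-≤-addEdges : ∀ δ es → total δ ≤ total (addEdges δ es)
  total-≤-addEdges δ []       = ≤-refl
  total-≤-addEdges δ (e ∷ es) = ≤-trans (total-≤-bump δ e) (total-≤-addEdges _ es)

  total-≤-addVertices : ∀ out δ us → total δ ≤ total (Lists.addVertices out δ us)
  total-≤-addVertices out δ []       = ≤-refl
  total-≤-addVertices out δ (u ∷ us) =
    ≤-trans (total-≤-addEdges δ (out u)) (total-≤-addVertices out _ us)

-- The loops over edges and vertices

module Loops {n : ℕ} (out : Fin n → List (Fin n)) (T₀ j N W : ℕ) (room : RoomFor N W)
             (n≤N : n ≤ N) (j≤N : j ≤ N) where
  open Run N W room
  open Steps program W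
  open Lists out
  open Totals {n} T₀ j

  -- The loop counters in cells 0 and 3 are left out; separate equations follow them as they count
  -- down.
  record Inv (δ : Fin n → ℕ) (m : Memory) : Set where
    field
      bounded  : Bounded W m
      index    : m 1 ≡ j
      count    : m 2 ≡ total δ
      degree   : ∀ v → m (10 + 2 * toℕ v) ≡ δ v
      binomial : ∀ v → m (11 + 2 * toℕ v) ≡ binom j (δ v)

  open Inv

  Inv-bump : ∀ {δ m m′} e → Inv δ m → Bounded W m′ →
    let d  = m (10 + 2 * toℕ e)
        b  = m (11 + 2 * toℕ e)
        b′ = nextBinom (m 1) d b
    in
    m′ 1 ≡ m 1 → m′ 2 ≡ (m 2 + b′) ∸ b →
    (∀ i → m′ (10 + i) ≡ (if i ≡ᵇ suc (2 * toℕ e) then b′ else if i ≡ᵇ 2 * toℕ e then suc d else m (10 + i))) →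
    Inv (updateAt δ e suc) m′
  Inv-bump {δ} {m} {m′} e I B eq₁ eq₂ cells = record
    { bounded  = B
    ; index    = trans eq₁ (index I)
    ; count    = trans eq₂ (begin
        (m 2 + b′) ∸ b                                         ≡⟨ cong₂ _∸_ (cong₂ _+_ (count I) b′≡) (binomial I e) ⟩
        (total δ + binom j (suc (δ e))) ∸ binom j (δ e)        ≡⟨ cong (_∸ binom j (δ e)) (total-bump δ e) ⟨
        (total (updateAt δ e suc) + binom j (δ e)) ∸ binom j (δ e)  ≡⟨ m+n∸n≡m _ (binom j (δ e)) ⟩
        total (updateAt δ e suc)                               ∎)
    ; degree   = λ v → trans (cells (2 * toℕ v)) (degree′ v)
    ; binomial = λ v → trans (cells (suc (2 * toℕ v))) (binomial′ v)
    }
    where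
    open ≡-Reasoning
    d  = m (10 + 2 * toℕ e)
    b  = m (11 + 2 * toℕ e)
    b′ = nextBinom (m 1) d b
    b′≡ : b′ ≡ binom j (suc (δ e))
    b′≡ rewrite index I | degree I e | binomial I e = refl

    doubles-differ : ∀ {u v : Fin n} → u ≢ v → (2 * toℕ u ≡ᵇ 2 * toℕ v) ≡ false
    doubles-differ {u} {v} u≢v =
      dec-false (2 * toℕ u ≟ 2 * toℕ v) (u≢v ∘ Fin.toℕ-injective ∘ *-cancelˡ-≡ (toℕ u) (toℕ v) 2)

    -- Degrees sit at even offsets and binomials at odd ones: parity separates the two kinds, and
    -- injectivity of doubling separates the vertices within a kind.
    degree′ : ∀ v → (if 2 * toℕ v ≡ᵇ suc (2 * toℕ e) then b′ else if 2 * toℕ v ≡ᵇ 2 * toℕ e then suc d else m (10 + 2 * toℕ v))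
                  ≡ updateAt δ e suc v
    degree′ v rewrite dec-false (2 * toℕ v ≟ suc (2 * toℕ e)) (even≢odd (toℕ v) (toℕ e)) with v Fin.≟ e
    ... | yes refl rewrite dec-true (2 * toℕ e ≟ 2 * toℕ e) refl =
      trans (cong suc (degree I e)) (sym (updateAt-updates e δ))
    ... | no v≢e rewrite doubles-differ v≢e = trans (degree I v) (sym (updateAt-minimal v e δ v≢e))

    binomial′ : ∀ v → (if 2 * toℕ v ≡ᵇ 2 * toℕ e then b′ else if suc (2 * toℕ v) ≡ᵇ 2 * toℕ e then suc d else m (11 + 2 * toℕ v))
                    ≡ binom j (updateAt δ e suc v)
    binomial′ v with v Fin.≟ e
    ... | yes refl rewrite dec-true (2 * toℕ e ≟ 2 * toℕ e) refl =
      trans b′≡ (cong (binom j) (sym (updateAt-updates e δ)))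
    ... | no v≢e rewrite doubles-differ v≢e
                       | dec-false (suc (2 * toℕ v) ≟ 2 * toℕ e) (even≢odd (toℕ e) (toℕ v) ∘ sym) =
      trans (binomial I v) (cong (binom j) (sym (updateAt-minimal v e δ v≢e)))

  edgeTime : ℕ → List (Fin n) → ℕ
  edgeTime T []       = suc T
  edgeTime T (_ ∷ es) = 19 + edgeTime T es

  -- The degree bound is an invariant because each edge shortens the list by one and raises any
  -- degree by at most one. For the count only the final total is bounded, and monotonicity passes
  -- this back to every earlier state.
  edge-loop : ∀ es {δ m is T os} → Inv δ m → m 3 ≡ length es →
    (∀ v → δ v + length es ≤ N) → total (addEdges δ es) ≤ N →
    (∀ m′ → Inv (addEdges δ es) m′ → m′ 0 ≡ m 0 → Halts program W ⟨ 7 , m′ , is , [] ⟩ T os) →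
    Halts program W ⟨ 10 , m , map toℕ es ++ is , [] ⟩ (edgeTime T es) os
  edge-loop [] {m = m} I eq _ _ rest =
    branch true refl (dec-true (m 3 ≟ 0) eq) (bounded I) (rest m I refl)
  edge-loop (e ∷ es) {δ} {m} I eq degrees≤ total≤ rest =
    edge-step (bounded I) (λ m3≡0 → 0≢1+n (trans (sym m3≡0) eq))
      (≤-trans (<⇒≤ (Fin.toℕ<n e)) n≤N)
      (subst (_≤ N) (sym (index I)) j≤N)
      (subst (_≤ N) (sym (count I)) (≤-trans (total-≤-bump δ e) total′≤))
      (subst (λ d → suc d ≤ N) (sym (degree I e)) (≤-trans (m≤m+n _ (length es)) (degrees′≤ e)))
      (subst (_≤ N) (sym (binomial I e)) (≤-trans (binom≤total δ e) (≤-trans (total-≤-bump δ e) total′≤)))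
      (subst (_≤ N) (sym new) (≤-trans (binom≤total (updateAt δ e suc) e) total′≤))
      λ m′ B eq₀ eq₁ eq₂ eq₃ cells →
        edge-loop es (Inv-bump e I B eq₁ eq₂ cells) (trans eq₃ (cong (_∸ 1) eq))
          (λ v → ≤-trans (+-monoˡ-≤ (length es) (bump-≤ δ e v)) (degrees′≤ v))
          total≤
          (λ m″ I″ eq₀′ → rest m″ I″ (trans eq₀′ eq₀))
    where
    total′≤ : total (updateAt δ e suc) ≤ N
    total′≤ = ≤-trans (total-≤-addEdges (updateAt δ e suc) es) total≤
    degrees′≤ : ∀ v → suc (δ v) + length es ≤ N
    degrees′≤ v = subst (_≤ N) (+-suc (δ v) (length es)) (degrees≤ v)
    new : nextBinom (m 1) (m (10 + 2 * toℕ e)) (m (11 + 2 * toℕ e)) ≡ binom j (updateAt δ e suc e)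
    new rewrite index I | degree I e | binomial I e | updateAt-updates e {suc} δ = refl

  -- The 2 stands for the last test and the `write`, since `halt` takes no step; the 3 for the test,
  -- the decrement and the reading of the list length.
  vertexTime : List (Fin n) → ℕ
  vertexTime []       = 2
  vertexTime (u ∷ us) = 3 + edgeTime (vertexTime us) (out u)

  vertex-loop : ∀ us {δ m} → Inv δ m → m 0 ≡ length us →
    (∀ v → δ v + edgesOf us ≤ N) → total (addVertices δ us) ≤ N →
    Halts program W ⟨ 7 , m , encodeLists us , [] ⟩ (vertexTime us) (total (addVertices δ us) ∷ [])
  vertex-loop [] {m = m} I eq _ _ =
    branch true refl (dec-true (m 0 ≟ 0) eq) (bounded I)
    (next (bounded I) refl
    (subst (λ x → Halts program W ⟨ 30 , m , [] , m 2 ∷ [] ⟩ 0 (x ∷ [])) (count I) (stop (bounded I) refl)))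
  vertex-loop (u ∷ us) {δ} {m} I eq degrees≤ total≤ =
    branch false refl (dec-false (m 0 ≟ 0) (λ m0≡0 → 0≢1+n (trans (sym m0≡0) eq))) (bounded I)
    (assign (m 0 ∸ 1) sub (bounded I) (≤-trans (m∸n≤m (m 0) 1) (bounded I 0)) λ B →
    readNext refl B (≤-trans length≤N N≤W) λ B →
    edge-loop (out u)
      -- Only cells 0 and 3 were overwritten, so the other fields carry over by computation.
      (record { bounded = B ; index = index I ; count = count I ; degree = degree I ; binomial = binomial I })
      refl
      (λ v → ≤-trans (+-monoʳ-≤ (δ v) (m≤m+n _ (edgesOf us))) (degrees≤ v))
      (≤-trans (total-≤-addVertices out _ us) total≤)
      λ m′ I′ eq′ →
        vertex-loop us I′ (trans eq′ (cong (_∸ 1) eq))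
          (λ v → ≤-trans (+-monoˡ-≤ (edgesOf us) (addEdges-≤ δ (out u) v))
                         (subst (_≤ N) (sym (+-assoc (δ v) _ _)) (degrees≤ v)))
          total≤)
    where
    length≤N : length (out u) ≤ N
    length≤N = ≤-trans (m≤m+n _ (edgesOf us)) (≤-trans (m≤n+m _ (δ u)) (degrees≤ u))

  edgeTime≡ : ∀ T es → edgeTime T es ≡ 19 * length es + suc T
  edgeTime≡ T []       = refl
  edgeTime≡ T (_ ∷ es) = trans (cong (19 +_) (edgeTime≡ T es)) (lemma (length es) T)
    where
    lemma : ∀ l T → 19 + (19 * l + suc T) ≡ 19 * suc l + suc T
    lemma = solve-∀

  vertexTime≡ : ∀ us → vertexTime us ≡ 2 + 4 * length us + 19 * edgesOf us
  vertexTime≡ []       = refl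
  vertexTime≡ (u ∷ us) =
    trans (cong (3 +_) (trans (edgeTime≡ (vertexTime us) (out u))
                              (cong (λ T → 19 * length (out u) + suc T) (vertexTime≡ us))))
          (lemma (length (out u)) (length us) (edgesOf us))
    where
    lemma : ∀ l a b → 3 + (19 * l + suc (2 + 4 * a + 19 * b)) ≡ 2 + 4 * suc a + 19 * (l + b)
    lemma = solve-∀

-- The first summand is n if k = 1 and 0 otherwise; it makes up for binom 0
-- being 0 where C(d, 0) = 1 is needed.
initialCount+∑binom≡∑choices : {n : ℕ} (δ : Fin n → ℕ) (k : ℕ) →
  (1 ∸ ((1 ∸ k) + (k ∸ 1))) * n + ∑ (λ v → binom (k ∸ 1) (δ v)) ≡ ∑ (λ v → choices 1 (δ v) k)
initialCount+∑binom≡∑choices δ 0 = sum-cong-≗ λ v → binom-0 (δ v)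
initialCount+∑binom≡∑choices {n} δ 1 = begin
  1 * n + ∑ (λ v → binom 0 (δ v))  ≡⟨ cong₂ _+_ (*-comm 1 n) (trans (sum-cong-≗ λ v → binom-0 (δ v)) (trans (∑-const n 0) (*-zeroʳ n))) ⟩
  n * 1 + 0                        ≡⟨ +-identityʳ _ ⟩
  n * 1                            ≡⟨ ∑-const n 1 ⟨
  ∑ {n} (λ v → 1)                  ≡⟨ sum-cong-≗ (λ v → sym (nC0≡1 (δ v))) ⟩
  ∑ (λ v → δ v C 0)                ∎
  where open ≡-Reasoning
initialCount+∑binom≡∑choices {n} δ (suc (suc i)) =
  cong₂ (λ a b → a * n + b) (0∸n≡0 i) (sum-cong-≗ λ v → binom-suc i (δ v))

-- Output and running time of the machine

module Correctness (x : CountingInstance) where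
  open CountingInstance x
  open AdjacencyLists lists
  open Counting G
  open Lists out

  -- Here the out-lists of the input meet the in-degrees of the counting formula: `out u` has no
  -- repetitions, so an edge from `u` to `v` is tallied exactly once.
  addEdges-out : ∀ δ u v → addEdges δ (out u) v ≡ δ v + isMay (role v u)
  addEdges-out δ u v with E? G u v | u Fin.≟ v
  ... | yes e | _ = trans (addEdges-∈ δ (unique u) (Equivalence.from (complete u v) e)) (+-comm 1 (δ v))
  ... | no ¬e | d = trans (addEdges-∉ δ (¬e ∘ Equivalence.to (complete u v))) (trans (sym (+-identityʳ _)) (cong (δ v +_) (none d)))
    where
    none : ∀ d → 0 ≡ isMay (roleOf (no ¬e) d)
    none (yes _) = refl
    none (no _)  = refl

  -- General in `g` because the tail of `allFin n` is a tabulation of shifted indices, to which the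
  -- induction must apply.
  addVertices-tabulate : ∀ {p} (g : Fin p → Fin n) δ v →
    addVertices δ (tabulate g) v ≡ δ v + ∑ (λ i → isMay (role v (g i)))
  addVertices-tabulate {zero}  g δ v = sym (+-identityʳ (δ v))
  addVertices-tabulate {suc p} g δ v = begin
    addVertices (addEdges δ (out (g zero))) (tabulate (g ∘ suc)) v  ≡⟨ addVertices-tabulate (g ∘ suc) _ v ⟩
    addEdges δ (out (g zero)) v + rest                              ≡⟨ cong (_+ rest) (addEdges-out δ (g zero) v) ⟩
    δ v + isMay (role v (g zero)) + rest                            ≡⟨ +-assoc (δ v) _ _ ⟩
    δ v + (isMay (role v (g zero)) + rest)                          ∎
    where
    open ≡-Reasoning
    rest = ∑ (λ i → isMay (role v (g (suc i))))

  T₀ : ℕ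
  T₀ = (1 ∸ ((1 ∸ k) + (k ∸ 1))) * n

  answer : ℕ
  answer = ∑ (λ v → choices 1 (indegree v) k)

  open Totals {n} T₀ (k ∸ 1)

  total≡answer : total (addVertices (λ _ → 0) (allFin n)) ≡ answer
  total≡answer = trans
    (cong (T₀ +_) (sum-cong-≗ λ v → cong (binom (k ∸ 1)) (addVertices-tabulate (λ u → u) (λ _ → 0) v)))
    (initialCount+∑binom≡∑choices indegree k)

  run : ∀ N W c → RoomFor N W → 20 ≤ c → n ≤ N → k ≤ N → edgeCount ≤ N → answer ≤ N →
        Σ ℕ λ t → Halts program W (initial (n ∷ k ∷ encodeGraph)) t (answer ∷ []) × t ≤ c * (1 + (n + edgeCount))
  run N W c room 20≤c n≤N k≤N edges≤N answer≤N = 7 + vertexTime (allFin n) , halts , time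
    where
    open RoomFor room
    open Run N W room
    open Steps program W
    open Loops out T₀ (k ∸ 1) N W room n≤N (≤-trans (m∸n≤m k 1) k≤N)

    a = (1 ∸ k) + (k ∸ 1)

    a≤W : a ≤ W
    a≤W = ≤-trans (+-mono-≤ (m∸n≤m 1 k) (≤-trans (m∸n≤m k 1) k≤N))
                  (≤-trans (+-mono-≤ (s≤s (z≤n {11})) (m≤m+n N _)) linear)

    T₀≤W : T₀ ≤ W
    T₀≤W = ≤-trans (*-monoˡ-≤ n (m∸n≤m 1 a)) (≤-trans (≤-reflexive (*-identityˡ n)) (≤-trans n≤N N≤W))

    halts : Halts program W (initial (n ∷ k ∷ encodeGraph)) (7 + vertexTime (allFin n)) (answer ∷ [])
    halts = subst (λ y → Halts program W (initial (n ∷ k ∷ encodeGraph)) (7 + vertexTime (allFin n)) (y ∷ [])) total≡answer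
      (readNext refl (λ _ → z≤n) (≤-trans n≤N N≤W) λ B →
      readNext refl B (≤-trans k≤N N≤W) λ B →
      assign (1 ∸ k) sub B (≤-trans (m∸n≤m 1 k) 1≤W) λ B →
      assign (k ∸ 1) sub B (≤-trans (m∸n≤m k 1) (≤-trans k≤N N≤W)) λ B →
      assign a add B a≤W λ B →
      assign (1 ∸ a) sub B (≤-trans (m∸n≤m 1 a) 1≤W) λ B →
      assign T₀ mul B T₀≤W λ B →
      vertex-loop (allFin n)
        (record { bounded = B ; index = refl ; count = start ; degree = λ _ → refl ; binomial = λ _ → refl })
        (sym (length-tabulate {n = n} (λ u → u)))
        (λ _ → edges≤N)
        (subst (_≤ N) (sym total≡answer) answer≤N))
      where
      start : T₀ ≡ total (λ _ → 0)
      start = sym (trans (cong (T₀ +_) (trans (∑-const n 0) (*-zeroʳ n))) (+-identityʳ T₀))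

    time : 7 + vertexTime (allFin n) ≤ c * (1 + (n + edgeCount))
    time = begin
      7 + vertexTime (allFin n)                          ≡⟨ cong (7 +_) (vertexTime≡ (allFin n)) ⟩
      9 + 4 * length (allFin n) + 19 * edgeCount         ≡⟨ cong (λ l → 9 + 4 * l + 19 * edgeCount) (length-tabulate {n = n} (λ u → u)) ⟩
      -- The added summand is the slack that fills each of the coefficients 9, 4 and 19 up to 20.
      9 + 4 * n + 19 * edgeCount                         ≤⟨ m≤m+n _ (11 + 16 * n + edgeCount) ⟩
      9 + 4 * n + 19 * edgeCount + (11 + 16 * n + edgeCount)  ≡⟨ lemma n edgeCount ⟩
      20 * (1 + (n + edgeCount))                         ≤⟨ *-monoˡ-≤ (1 + (n + edgeCount)) 20≤c ⟩
      c * (1 + (n + edgeCount))                          ∎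
      where
      open ≤-Reasoning
      lemma : ∀ a b → 9 + 4 * a + 19 * b + (11 + 16 * a + b) ≡ 20 * (1 + (a + b))
      lemma = solve-∀

-- As `N` is at least 2, the constant 12 fits below `2 ^ 4` and hence `N ^ 4`, and a factor 2 costs
-- one more power.
^-roomFor : ∀ {N c} → 2 ≤ N → 5 ≤ c → RoomFor N (N ^ c)
^-roomFor {N} {c} 2≤N 5≤c = record
  { linear    = begin
      12 + 2 * N     ≤⟨ +-mono-≤ (m≤m+n 12 4) (*-monoˡ-≤ N 2≤N) ⟩
      2 ^ 4 + N * N  ≤⟨ +-mono-≤ (^-monoˡ-≤ 4 2≤N) (≤-trans (≤-reflexive N*N≡N^2) (^-monoʳ-≤ N (m≤m+n 2 2))) ⟩
      N ^ 4 + N ^ 4  ≡⟨ cong (N ^ 4 +_) (+-identityʳ (N ^ 4)) ⟨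
      2 * N ^ 4      ≤⟨ *-monoˡ-≤ (N ^ 4) 2≤N ⟩
      N ^ 5          ≤⟨ ^-monoʳ-≤ N 5≤c ⟩
      N ^ c          ∎
  ; quadratic = ≤-trans (≤-reflexive N*N≡N^2) (^-monoʳ-≤ N (≤-trans (m≤m+n 2 3) 5≤c))
  }
  where
  open ≤-Reasoning
  instance
    N≢0 : NonZero N
    N≢0 = >-nonZero (<⇒≤ 2≤N)
  N*N≡N^2 : N * N ≡ N ^ 2
  N*N≡N^2 = cong (N *_) (sym (*-identityʳ N))

-- c is a variable so that the power in the word bound does not unfold.
sinkCount-linearTime : ∀ c → 20 ≤ c → LinearTime (#IndSub Ψsink)
sinkCount-linearTime c 20≤c = program , c , λ x →
  let open CountingInstance x
      open AdjacencyLists lists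
      open Correctness x
      s = n + edgeCount
      M = foldr _⊔_ 0 (n ∷ k ∷ encodeGraph)
      s≤N = ≤-trans (m≤n+m s 2) (≤-trans (m≤m+n (2 + s) M) (m≤m+n (2 + s + M) answer))
      M≤N = ≤-trans (m≤n+m M (2 + s)) (m≤m+n (2 + s + M) answer)
  in answer , map₂ (Counting.sinkSets-cardinality G noAntiparallel k ,_)
       (run (2 + s + M + answer) ((2 + s + M + answer) ^ c) c
         (^-roomFor (s≤s (s≤s z≤n)) (≤-trans (m≤m+n 5 15) 20≤c)) 20≤c
         (≤-trans (m≤m+n n edgeCount) s≤N)
         -- `k` may exceed the size of the graph; its bound comes from the largest input number.
         (≤-trans (≤-trans (m≤m⊔n k _) (m≤n⊔m n _)) M≤N)
         (≤-trans (m≤n+m edgeCount n) s≤N)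
         (m≤n+m answer (2 + s + M)))

-- An in-star has its centre as sink. The edgeless graph has none once there is a second vertex; on
-- a single vertex the sink condition is vacuous.
Ψsink-nontrivial : ∀ k → 2 ≤ k → NontrivialOn k Ψsink
Ψsink-nontrivial (suc zero) (s≤s ())
Ψsink-nontrivial (suc (suc k)) _ =
  (star , noAntiparallel , zero , λ u u≢0 → refl , u≢0) ,
  (edgeless , (λ _ _ → proj₁) , noSink)
  where
  star : Digraph (Fin (2 + k))
  star = record
    { E      = λ u v → v ≡ zero × u ≢ zero
    ; E?     = λ u v → (v Fin.≟ zero) ×-dec ¬? (u Fin.≟ zero)
    ; noLoop = λ v (v≡0 , v≢0) → v≢0 v≡0
    }
  noAntiparallel : NoAntiparallel star
  noAntiparallel u v ((v≡0 , _) , (_ , v≢0)) = v≢0 v≡0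
  edgeless : Digraph (Fin (2 + k))
  edgeless = record { E = λ _ _ → ⊥ ; E? = λ _ _ → no λ () ; noLoop = λ _ () }
  noSink : ¬ Ψsink edgeless
  noSink (zero  , sink) = sink (suc zero) λ ()
  noSink (suc s , sink) = sink zero λ ()

mainTheorem3 : ((k : ℕ) → 2 ≤ k → NontrivialOn k Ψsink) × LinearTime (#IndSub Ψsink)
mainTheorem3 = Ψsink-nontrivial , sinkCount-linearTime 20 ≤-refl
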